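{- For every integer $m\geq 2$ and every integer $n\geq 3$, the graph $mF_n$ (the disjoint union of $m$ copies of the fan $F_n$) is $C_3$-supermagic.
   Context: All graphs are finite and simple. For a graph $H$, a graph $G=(V,E)$ has an $H$-covering if every edge of $G$ belongs to a subgraph of $G$ isomorphic to $H$. For such $G$, an $H$-magic labeling is a bijection $\lambda: V\cup E\to\{1,2,\dots,|V|+|E|\}$ for which there is a constant $c$ such that for every subgraph $H'=(V',E')$ of $G$ isomorphic to $H$, $\sum_{v\in V'}\lambda(v)+\sum_{e\in E'}\lambda(e)=c$. It is $H$-supermagic if moreover $\{\lambda(v):v\in V\}=\{1,\dots,|V|\}$; $G$ is $H$-supermagic if it admits such a labeling. $C_k$ is the cycle of length $k$. $mG$ denotes the disjoint union of $m$ copies of $G$. For $n\geq 3$, the fan $F_n=K_1+P_n$ has vertices $c,v_1,\dots,v_n$ and edges $cv_i$ ($1\le i\le n$) and $v_iv_{i+1}$ ($1\le i\le n-1$). -}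

module Defs where

open import Data.Bool.Base using (Bool; true; false; T)
open import Data.Bool.Properties using (T-irrelevant)
open import Data.Empty using (⊥; ⊥-elim)
open import Data.Fin.Base as Fin using (Fin; toℕ; inject₁)
open import Data.Fin.Properties using (toℕ<n; toℕ-inject₁; toℕ-fromℕ<; +↔⊎; *↔×; 0↔⊥; 1↔⊤) renaming (suc-injective to Fin-suc-injective)
open import Data.Nat.Base using (ℕ; zero; suc; _+_; _*_; _∸_; _≤_; _<_; s≤s; z≤n; NonZero)
open import Data.Nat.DivMod using (_%_; _mod_; m%n<n; m<n⇒m%n≡m; m≤n⇒[n∸m]%m≡n%m; %-distribˡ-+)
open import Data.Nat.Properties using (≤-refl; ≤-trans; <-trans; <⇒≢; ≮⇒≥; n<1+n; m<n+m; m∸n+n≡m; +-comm; +-monoʳ-<; +-cancelʳ-<; _<?_; +-0-commutativeMonoid)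
open import Data.Product.Base using (Σ-syntax; ∃-syntax; _×_; _,_; proj₁; proj₂)
open import Data.Product.Function.NonDependent.Propositional using (_×-↔_)
open import Data.Sum.Base using (_⊎_; inj₁; inj₂)
open import Data.Sum.Function.Propositional using (_⊎-↔_)
open import Function.Base using (_∘_)
open import Function.Bundles using (_↔_; _⤖_; _⇔_; Inverse; Bijection; mk↔ₛ′)
open import Function.Construct.Composition using (_↔-∘_)
open import Function.Construct.Identity using (↔-id)
open import Relation.Nullary.Decidable.Core using (yes; no)
open import Relation.Binary.PropositionalEquality using (_≡_; _≢_; refl; sym; trans; cong; cong₂; subst; module ≡-Reasoning)

open import Algebra.Properties.CommutativeMonoid.Sum +-0-commutativeMonoid using (sum)

record Finite (A : Set) : Set where
  field
    size : ℕ
    enum : Fin size ↔ A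

open Finite

∑ : {A : Set} → Finite A → (A → ℕ) → ℕ
∑ fin f = sum (f ∘ Inverse.to (enum fin))

finite-Fin : (n : ℕ) → Finite (Fin n)
finite-Fin n = record { size = n ; enum = ↔-id (Fin n) }

finite-↔ : {A B : Set} → A ↔ B → Finite A → Finite B
finite-↔ i fin = record { size = size fin ; enum = i ↔-∘ enum fin }

finite-⊎ : {A B : Set} → Finite A → Finite B → Finite (A ⊎ B)
finite-⊎ fA fB = record
  { size = size fA + size fB
  ; enum = (enum fA ⊎-↔ enum fB) ↔-∘ +↔⊎
  }

finite-× : {A B : Set} → Finite A → Finite B → Finite (A × B)
finite-× fA fB = record
  { size = size fA * size fB
  ; enum = (enum fA ×-↔ enum fB) ↔-∘ *↔×
  }

finite-T : (b : Bool) → Finite (T b)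
finite-T false = record { size = 0 ; enum = 0↔⊥ }
finite-T true  = record { size = 1 ; enum = 1↔⊤ }

Subset : Set → Set
Subset A = A → Bool

infix 4 _∈_

_∈_ : {A : Set} → A → Subset A → Set
x ∈ P = T (P x)

Elements : {A : Set} → Subset A → Set
Elements {A} P = Σ[ x ∈ A ] x ∈ P

Elements-≡ : {A : Set} (P : Subset A) {x y : Elements P} → proj₁ x ≡ proj₁ y → x ≡ y
Elements-≡ P {x , p} {.x , q} refl = cong (x ,_) (T-irrelevant p q)

private
  finite-subset-Fin : (n : ℕ) (P : Subset (Fin n)) → Finite (Elements P)
  finite-subset-Fin zero    P = record
    { size = 0 ; enum = mk↔ₛ′ (λ ()) (λ { (() , _) }) (λ { (() , _) }) (λ ()) }
  finite-subset-Fin (suc n) P =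
    finite-↔ split (finite-⊎ (finite-T (P Fin.zero)) (finite-subset-Fin n (P ∘ Fin.suc)))
    where
    split : (T (P Fin.zero) ⊎ Elements (P ∘ Fin.suc)) ↔ Elements P
    split = mk↔ₛ′
      (λ { (inj₁ p) → Fin.zero , p ; (inj₂ (i , p)) → Fin.suc i , p })
      (λ { (Fin.zero , p) → inj₁ p ; (Fin.suc i , p) → inj₂ (i , p) })
      (λ { (Fin.zero , p) → refl ; (Fin.suc i , p) → refl })
      (λ { (inj₁ p) → refl ; (inj₂ (i , p)) → refl })

finite-subset : {A : Set} → Finite A → (P : Subset A) → Finite (Elements P)
finite-subset {A} fin P = finite-↔ reindex (finite-subset-Fin (size fin) (P ∘ to))
  where
  open Inverse (enum fin)
  reindex : Elements (P ∘ to) ↔ Elements P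
  reindex = mk↔ₛ′
    (λ { (i , p) → to i , p })
    (λ { (x , p) → from x , subst (_∈ P) (sym (strictlyInverseˡ x)) p })
    (λ { (x , p) → Elements-≡ P (strictlyInverseˡ x) })
    (λ { (i , p) → Elements-≡ (P ∘ to) (strictlyInverseʳ i) })

-- Edges form a set of their own, since they carry labels.  The order of the
-- two ends of an edge is an artefact: only `Joins`, which is symmetric, is
-- used to compare graphs.
record Graph : Set₁ where
  field
    V        : Set
    E        : Set
    finite-V : Finite V
    finite-E : Finite E
    end₁     : E → V
    end₂     : E → V

  Joins : E → V → V → Set
  Joins e u v = (end₁ e ≡ u × end₂ e ≡ v) ⊎ (end₁ e ≡ v × end₂ e ≡ u)

  field
    loopless    : ∀ e → end₁ e ≢ end₂ e
    no-parallel : ∀ {e f u v} → Joins e u v → Joins f u v → e ≡ f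

  Adjacent : V → V → Set
  Adjacent u v = ∃[ e ] Joins e u v

  ∣V∣ : ℕ
  ∣V∣ = size finite-V

  ∣E∣ : ℕ
  ∣E∣ = size finite-E

record _≅_ (G H : Graph) : Set where
  private
    module G = Graph G
    module H = Graph H
  field
    vertices : G.V ↔ H.V
    adjacent : ∀ u v → G.Adjacent u v ⇔ H.Adjacent (Inverse.to vertices u) (Inverse.to vertices v)

infix 4 _≅_

record Subgraph (G : Graph) : Set where
  open Graph G
  field
    V′      : Subset V
    E′      : Subset E
    end₁-∈ : ∀ e → e ∈ E′ → end₁ e ∈ V′
    end₂-∈ : ∀ e → e ∈ E′ → end₂ e ∈ V′

⟦_⟧ : {G : Graph} → Subgraph G → Graph
⟦_⟧ {G} S = record
  { V           = Elements V′
  ; E           = Elements E′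
  ; finite-V    = finite-subset finite-V V′
  ; finite-E    = finite-subset finite-E E′
  ; end₁        = λ (e , p) → end₁ e , end₁-∈ e p
  ; end₂        = λ (e , p) → end₂ e , end₂-∈ e p
  ; loopless    = λ (e , _) eq → loopless e (cong proj₁ eq)
  ; no-parallel = λ j k → Elements-≡ E′ (no-parallel (forget j) (forget k))
  }
  where
  open Graph G
  open Subgraph S
  forget : {x y u v : Elements V′} → (x ≡ u × y ≡ v) ⊎ (x ≡ v × y ≡ u) →
           (proj₁ x ≡ proj₁ u × proj₁ y ≡ proj₁ v) ⊎ (proj₁ x ≡ proj₁ v × proj₁ y ≡ proj₁ u)
  forget (inj₁ (p , q)) = inj₁ (cong proj₁ p , cong proj₁ q)
  forget (inj₂ (p , q)) = inj₂ (cong proj₁ p , cong proj₁ q)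

HasCovering : (H G : Graph) → Set
HasCovering H G = ∀ e → ∃[ S ] e ∈ Subgraph.E′ {G} S × ⟦ S ⟧ ≅ H

Labeling : Graph → Set
Labeling G = (V ⊎ E) ⤖ Fin (∣V∣ + ∣E∣)
  where open Graph G

module _ {G : Graph} (ℓ : Labeling G) where
  open Graph G

  -- Fin N stands for {1, …, N}, hence the shift by one.
  label : V ⊎ E → ℕ
  label x = suc (toℕ (Bijection.to ℓ x))

  weight : Subgraph G → ℕ
  weight S = ∑ (Graph.finite-V ⟦ S ⟧) (label ∘ inj₁ ∘ proj₁)
           + ∑ (Graph.finite-E ⟦ S ⟧) (label ∘ inj₂ ∘ proj₁)

  IsMagic : Graph → Set
  IsMagic H = ∃[ c ] ∀ S → ⟦ S ⟧ ≅ H → weight S ≡ c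

  IsSupermagic : Graph → Set
  IsSupermagic H = IsMagic H × (∀ k → (∃[ v ] label (inj₁ v) ≡ k) ⇔ (1 ≤ k × k ≤ ∣V∣))

Supermagic : (H G : Graph) → Set
Supermagic H G = HasCovering H G × ∃[ ℓ ] IsSupermagic {G} ℓ H

private
  shift-≢ : ∀ k .{{_ : NonZero k}} {i d} → i < k → 0 < d → d < k → (d + i) % k ≢ i
  shift-≢ k {i} {d} i<k 0<d d<k eq with d + i <? k
  ... | yes lt = <⇒≢ (m<n+m i 0<d) (sym (trans (sym (m<n⇒m%n≡m lt)) eq))
  ... | no  ge = <⇒≢ d+i∸k<i (trans (sym (m<n⇒m%n≡m (<-trans d+i∸k<i i<k))) (trans (m≤n⇒[n∸m]%m≡n%m (≮⇒≥ ge)) eq))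
    where
    d+i∸k<i : d + i ∸ k < i
    d+i∸k<i = +-cancelʳ-< k (d + i ∸ k) i
      (subst (_< i + k) (sym (m∸n+n≡m (≮⇒≥ ge))) (subst (_< i + k) (+-comm i d) (+-monoʳ-< i d<k)))

next : {n : ℕ} → Fin (suc n) → Fin (suc n)
next {n} i = suc (toℕ i) mod suc n

private
  toℕ-next : ∀ {n} (i : Fin (suc n)) → toℕ (next i) ≡ suc (toℕ i) % suc n
  toℕ-next {n} i = toℕ-fromℕ< (m%n<n (suc (toℕ i)) (suc n))

  next-≢ : ∀ {n} → 3 ≤ suc n → (i : Fin (suc n)) → i ≢ next i
  next-≢ {n} 3≤k i eq = shift-≢ (suc n) {d = 1} (toℕ<n i) (s≤s z≤n) (≤-trans (s≤s (s≤s z≤n)) 3≤k)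
    (trans (sym (toℕ-next i)) (cong toℕ (sym eq)))

  next²-≢ : ∀ {n} → 3 ≤ suc n → (i : Fin (suc n)) → next (next i) ≢ i
  next²-≢ {n} 3≤k i eq = shift-≢ (suc n) {d = 2} (toℕ<n i) (s≤s z≤n) 3≤k (begin
    suc (suc (toℕ i)) % suc n                         ≡⟨ %-distribˡ-+ 1 (suc (toℕ i)) (suc n) ⟩
    (1 % suc n + suc (toℕ i) % suc n) % suc n         ≡⟨ cong (λ x → (x + suc (toℕ i) % suc n) % suc n) (m<n⇒m%n≡m (≤-trans (s≤s (s≤s z≤n)) 3≤k)) ⟩
    suc (suc (toℕ i) % suc n) % suc n                 ≡⟨ cong (λ x → suc x % suc n) (sym (toℕ-next i)) ⟩
    suc (toℕ (next i)) % suc n                        ≡⟨ sym (toℕ-next (next i)) ⟩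
    toℕ (next (next i))                               ≡⟨ cong toℕ eq ⟩
    toℕ i                                             ∎)
    where open ≡-Reasoning

Cycle : (k : ℕ) → 3 ≤ k → Graph
Cycle (suc n) 3≤k = record
  { V           = Fin (suc n)
  ; E           = Fin (suc n)
  ; finite-V    = finite-Fin (suc n)
  ; finite-E    = finite-Fin (suc n)
  ; end₁        = λ i → i
  ; end₂        = next
  ; loopless    = next-≢ 3≤k
  ; no-parallel = λ
    { (inj₁ (refl , _))    (inj₁ (refl , _))    → refl
    ; (inj₁ (refl , refl)) (inj₂ (refl , q))    → ⊥-elim (next²-≢ 3≤k _ q)
    ; (inj₂ (refl , refl)) (inj₁ (refl , q))    → ⊥-elim (next²-≢ 3≤k _ q)
    ; (inj₂ (refl , _))    (inj₂ (refl , _))    → refl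
    }
  }

C₃ : Graph
C₃ = Cycle 3 ≤-refl

data FanVertex (n : ℕ) : Set where
  centre : FanVertex n
  rim    : Fin n → FanVertex n

data FanEdge : ℕ → Set where
  spoke : ∀ {n} → Fin n → FanEdge n
  path  : ∀ {n} → Fin n → FanEdge (suc n)

fan-end₁ : ∀ {n} → FanEdge n → FanVertex n
fan-end₁ (spoke i) = centre
fan-end₁ (path i)  = rim (inject₁ i)

fan-end₂ : ∀ {n} → FanEdge n → FanVertex n
fan-end₂ (spoke i) = rim i
fan-end₂ (path i)  = rim (Fin.suc i)

finite-FanVertex : (n : ℕ) → Finite (FanVertex n)
finite-FanVertex n = record
  { size = suc n
  ; enum = mk↔ₛ′
      (λ { Fin.zero → centre ; (Fin.suc i) → rim i })
      (λ { centre → Fin.zero ; (rim i) → Fin.suc i })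
      (λ { centre → refl ; (rim i) → refl })
      (λ { Fin.zero → refl ; (Fin.suc i) → refl })
  }

finite-FanEdge : (n : ℕ) → Finite (FanEdge n)
finite-FanEdge zero    = record
  { size = 0 ; enum = mk↔ₛ′ (λ ()) (λ { (spoke ()) }) (λ { (spoke ()) }) (λ ()) }
finite-FanEdge (suc n) = finite-↔
  (mk↔ₛ′
    (λ { (inj₁ i) → spoke i ; (inj₂ i) → path i })
    (λ { (spoke i) → inj₁ i ; (path i) → inj₂ i })
    (λ { (spoke i) → refl ; (path i) → refl })
    (λ { (inj₁ i) → refl ; (inj₂ i) → refl }))
  (finite-⊎ (finite-Fin (suc n)) (finite-Fin n))

private
  rim-injective : ∀ {n} {i j : Fin n} → rim i ≡ rim j → i ≡ j
  rim-injective refl = refl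

  inject₁≢suc : ∀ {n} (i : Fin n) → inject₁ i ≢ Fin.suc i
  inject₁≢suc i eq = <⇒≢ (n<1+n (toℕ i)) (trans (sym (toℕ-inject₁ i)) (cong toℕ eq))

  fan-loopless : ∀ {n} (e : FanEdge n) → fan-end₁ e ≢ fan-end₂ e
  fan-loopless (spoke i) ()
  fan-loopless (path i)  eq = inject₁≢suc i (rim-injective eq)

  fan-same : ∀ {n} (e f : FanEdge n) → fan-end₁ e ≡ fan-end₁ f → fan-end₂ e ≡ fan-end₂ f → e ≡ f
  fan-same (spoke i) (spoke j) _ q = cong spoke (rim-injective q)
  fan-same (path i)  (path j)  _ q = cong path (Fin-suc-injective (rim-injective q))

  fan-crossed : ∀ {n} (e f : FanEdge n) → fan-end₁ e ≡ fan-end₂ f → fan-end₂ e ≡ fan-end₁ f → ⊥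
  fan-crossed (spoke i) (spoke j) () q
  fan-crossed (spoke i) (path j)  () q
  fan-crossed (path i)  (spoke j) p ()
  fan-crossed (path i)  (path j)  p q = <⇒≢ (<-trans (n<1+n (toℕ j)) (n<1+n (suc (toℕ j)))) (sym (begin
    suc (suc (toℕ j))     ≡⟨ cong suc (cong toℕ (rim-injective p)) ⟨
    suc (toℕ (inject₁ i)) ≡⟨ cong suc (toℕ-inject₁ i) ⟩
    suc (toℕ i)           ≡⟨ cong toℕ (rim-injective q) ⟩
    toℕ (inject₁ j)       ≡⟨ toℕ-inject₁ j ⟩
    toℕ j                 ∎))
    where open ≡-Reasoning

Fan : ℕ → Graph
Fan n = record
  { V           = FanVertex n
  ; E           = FanEdge n
  ; finite-V    = finite-FanVertex n
  ; finite-E    = finite-FanEdge n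
  ; end₁        = fan-end₁
  ; end₂        = fan-end₂
  ; loopless    = fan-loopless
  ; no-parallel = λ {e} {f} → λ
    { (inj₁ (p , q)) (inj₁ (r , s)) → fan-same e f (trans p (sym r)) (trans q (sym s))
    ; (inj₁ (p , q)) (inj₂ (r , s)) → ⊥-elim (fan-crossed e f (trans p (sym s)) (trans q (sym r)))
    ; (inj₂ (p , q)) (inj₁ (r , s)) → ⊥-elim (fan-crossed e f (trans p (sym s)) (trans q (sym r)))
    ; (inj₂ (p , q)) (inj₂ (r , s)) → fan-same e f (trans p (sym r)) (trans q (sym s))
    }
  }

infixr 7 _copies-of_

_copies-of_ : ℕ → Graph → Graph
m copies-of G = record
  { V           = Fin m × V
  ; E           = Fin m × E
  ; finite-V    = finite-× (finite-Fin m) finite-V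
  ; finite-E    = finite-× (finite-Fin m) finite-E
  ; end₁        = λ (i , e) → i , end₁ e
  ; end₂        = λ (i , e) → i , end₂ e
  ; loopless    = λ (_ , e) eq → loopless e (cong proj₂ eq)
  ; no-parallel = λ j k → cong₂ _,_ (trans (index j) (sym (index k))) (no-parallel (forget j) (forget k))
  }
  where
  open Graph G
  index : {i : Fin m} {x y : V} {u v : Fin m × V} →
          ((i , x) ≡ u × (i , y) ≡ v) ⊎ ((i , x) ≡ v × (i , y) ≡ u) → i ≡ proj₁ u
  index (inj₁ (refl , _)) = refl
  index (inj₂ (_ , refl)) = refl
  forget : {i : Fin m} {x y : V} {u v : Fin m × V} →
           ((i , x) ≡ u × (i , y) ≡ v) ⊎ ((i , x) ≡ v × (i , y) ≡ u) →
           (x ≡ proj₂ u × y ≡ proj₂ v) ⊎ (x ≡ proj₂ v × y ≡ proj₂ u)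
  forget (inj₁ (refl , refl)) = inj₁ (refl , refl)
  forget (inj₂ (refl , refl)) = inj₂ (refl , refl)

{-# OPTIONS --safe #-}

-- Number the vertices of the fan c, v₁, …, vₙ along the fan, and its edges by
-- first the spokes at even positions (counted from 0), then the spokes at odd
-- positions, then the path.  Two consecutive spokes then have numbers summing
-- to a constant plus their position, so that over the triangle c vᵢ vᵢ₊₁ the
-- vertex numbers and the edge numbers both grow by 2 per step.  In m copies,
-- the j-th copy of an object numbered x gets m x + j, and the edge labels are
-- reversed.  A triangle has three vertices and three edges, so both the
-- dependence on the position and the dependence on the copy cancel.
module Submission where

open import Defs
open import Algebra.Properties.CommutativeMonoid.Sum using (sum-permute; sum-cong-≗)
open import Data.Fin.Base using (Fin; zero; suc; toℕ; fromℕ<; inject₁; combine; opposite)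
open import Data.Fin.Patterns using (0F; 1F; 2F)
open import Data.Fin.Permutation using (cast-id; reverse)
open import Data.Fin.Properties using (toℕ<n; toℕ-inject₁; toℕ-fromℕ<; toℕ-cast; toℕ-combine; toℕ-↑ˡ; toℕ-↑ʳ; opposite-prop; any?; +↔⊎; *↔×)
  renaming (_≟_ to _≟ᶠ_)
open import Data.Nat using (ℕ; zero; suc; _+_; _*_; _∸_; _≤_; s≤s; z≤n; ⌊_/2⌋; ⌈_/2⌉; parity)
open import Data.Nat.Properties using (≤-trans; +-comm; +-assoc; +-suc; *-comm; +-cancelˡ-≡; +-0-commutativeMonoid; m+n∸n≡m; m∸n+n≡m; ⌊n/2⌋+⌈n/2⌉≡n)
open import Data.Nat.Tactic.RingSolver using (solve-∀)
open import Data.Parity.Base using (_⁻¹)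
open import Data.Parity.Properties using (p≢p⁻¹; suc-homo-⁻¹; ⁻¹-involutive)
open import Data.Product.Algebra using (×-comm)
open import Data.Product.Base using (_×_; _,_; proj₁; proj₂; ∃-syntax)
open import Data.Product.Function.NonDependent.Propositional using (_×-↔_)
open import Data.Sum.Base using (_⊎_; inj₁; inj₂; swap; [_,_]′)
open import Data.Sum.Function.Propositional using (_⊎-↔_)
open import Data.Empty using (⊥; ⊥-elim)
open import Function.Base using (_∘_)
open import Function.Bundles using (_↔_; _⇔_; Inverse; Equivalence; mk↔ₛ′; mk⇔)
open import Function.Construct.Composition using (_↔-∘_)
open import Function.Construct.Identity using (↔-id)
open import Function.Construct.Symmetry using (↔-sym; ⇔-sym)
open import Function.Properties.Inverse using (↔⇒⤖; ↔⇒↣)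
open import Relation.Binary.Definitions using (DecidableEquality)
open import Relation.Binary.PropositionalEquality using (_≡_; _≢_; refl; sym; trans; cong; cong₂; subst; subst₂; module ≡-Reasoning)
open import Relation.Nullary.Decidable using (Dec; ⌊_⌋; toWitness; fromWitness; via-injection)

open import Algebra.Properties.CommutativeMonoid.Sum +-0-commutativeMonoid using (sum)

-- Sums and equality on finite types

open Inverse using (to; from; strictlyInverseˡ; strictlyInverseʳ)

-- Two enumerations of one type differ by a permutation, which leaves the sum unchanged. This lets a
-- weight, computed along the enumeration of a subset, be read off the three corners and sides of a
-- triangle.
∑-reindex : ∀ {A : Set} {k} (fin : Finite A) (φ : Fin k ↔ A) (f : A → ℕ) → ∑ fin f ≡ sum (f ∘ to φ)
∑-reindex fin φ f = trans
  (sum-permute +-0-commutativeMonoid (f ∘ to (Finite.enum fin)) (↔-sym (Finite.enum fin) ↔-∘ φ))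
  (sum-cong-≗ +-0-commutativeMonoid (λ i → cong f (strictlyInverseˡ (Finite.enum fin) (to φ i))))

finite-≟ : ∀ {A : Set} → Finite A → DecidableEquality A
finite-≟ fin = via-injection (↔⇒↣ (↔-sym (Finite.enum fin))) _≟ᶠ_

-- Isomorphisms and triangles

joins-ends : ∀ (G : Graph) {e} → Graph.Joins G e (Graph.end₁ G e) (Graph.end₂ G e)
joins-ends G = inj₁ (refl , refl)

-- `Joins` leaves the orientation of an edge open; symmetry of `P` absorbs the possible flip, so
-- later proofs need no case split on it.
joins-map : ∀ {A B : Set} (f : A → B) {x y u v : A} {P : B → B → Set} →
  (∀ {s t} → P s t → P t s) →
  (x ≡ u × y ≡ v) ⊎ (x ≡ v × y ≡ u) → P (f x) (f y) → P (f u) (f v)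
joins-map f sym-P (inj₁ (refl , refl)) p = p
joins-map f sym-P (inj₂ (refl , refl)) p = sym-P p

ends-sym : ∀ {A : Set} {x y u v : A} → (x ≡ u × y ≡ v) ⊎ (x ≡ v × y ≡ u) → (u ≡ x × v ≡ y) ⊎ (u ≡ y × v ≡ x)
ends-sym (inj₁ (p , q)) = inj₁ (sym p , sym q)
ends-sym (inj₂ (p , q)) = inj₂ (sym q , sym p)

≅-sym : ∀ {G H} → G ≅ H → H ≅ G
≅-sym {G} {H} iso = record
  { vertices = ↔-sym vertices
  ; adjacent = λ u v → ⇔-sym (subst₂ (λ x y → Graph.Adjacent G (from vertices u) (from vertices v) ⇔ Graph.Adjacent H x y)
      (strictlyInverseˡ vertices u) (strictlyInverseˡ vertices v) (adjacent _ _))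
  }
  where
  open _≅_ iso

module _ {G H : Graph} (iso : G ≅ H) where
  private
    module G = Graph G
    module H = Graph H
  open _≅_ iso

  -- An isomorphism records only adjacency. The map on edges is recovered from the witness that the
  -- images of the two ends are adjacent.
  edge-image : G.E → H.E
  edge-image e = proj₁ (Equivalence.to (adjacent _ _) (e , joins-ends G))

  edge-image-joins : ∀ {e u v} → G.Joins e u v → H.Joins (edge-image e) (to vertices u) (to vertices v)
  edge-image-joins {e} j = joins-map (to vertices) {P = H.Joins (edge-image e)} swap j
    (proj₂ (Equivalence.to (adjacent _ _) (e , joins-ends G)))

-- Going forth and back gives an edge with the same ends, and there are no parallel edges.
edge-image-inverse : ∀ {G H} (iso : G ≅ H) e → edge-image (≅-sym iso) (edge-image iso e) ≡ e
edge-image-inverse {G} iso e = Graph.no-parallel G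
  (subst₂ (Graph.Joins G _) (strictlyInverseʳ vertices _) (strictlyInverseʳ vertices _)
    (edge-image-joins (≅-sym iso) (edge-image-joins iso (joins-ends G))))
  (joins-ends G)
  where open _≅_ iso

edge-image-inverse′ : ∀ {G H} (iso : G ≅ H) f → edge-image iso (edge-image (≅-sym iso) f) ≡ f
edge-image-inverse′ {G} {H} iso f = Graph.no-parallel H
  (subst₂ (Graph.Joins H _) (strictlyInverseˡ vertices _) (strictlyInverseˡ vertices _)
    (edge-image-joins iso (edge-image-joins (≅-sym iso) (joins-ends H))))
  (joins-ends H)
  where open _≅_ iso

≅⇒edges : ∀ {G H} → G ≅ H → Graph.E G ↔ Graph.E H
≅⇒edges iso = mk↔ₛ′ (edge-image iso) (edge-image (≅-sym iso)) (edge-image-inverse′ iso) (edge-image-inverse iso)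

-- A copy of `C₃` as bare data, indexed cyclically like `C₃` itself. Distinctness of the corners
-- comes from looplessness.
record Triangle (G : Graph) : Set where
  open Graph G
  field
    corner : Fin 3 → V
    side   : Fin 3 → E
    joins  : ∀ i → Joins (side i) (corner i) (corner (next i))

triangle-weight : ∀ {G} → (Graph.V G → ℕ) → (Graph.E G → ℕ) → Triangle G → ℕ
triangle-weight f g t = sum (f ∘ Triangle.corner t) + sum (g ∘ Triangle.side t)

module _ {G : Graph} (S : Subgraph G) (iso : ⟦ S ⟧ ≅ C₃) where
  open _≅_ iso

  subgraph⇒triangle : Triangle G
  subgraph⇒triangle = record
    { corner = proj₁ ∘ from vertices
    ; side   = proj₁ ∘ edge-image (≅-sym iso)
    ; joins  = λ i → joins-map proj₁ {P = Graph.Joins G _} swap (edge-image-joins (≅-sym iso) {i} (joins-ends C₃)) (joins-ends G)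
    }

  weight≡triangle-weight : (ℓ : Labeling G) →
    weight ℓ S ≡ triangle-weight (label {G} ℓ ∘ inj₁) (label {G} ℓ ∘ inj₂) subgraph⇒triangle
  weight≡triangle-weight ℓ = cong₂ _+_
    (∑-reindex (Graph.finite-V ⟦ S ⟧) (↔-sym vertices) (label {G} ℓ ∘ inj₁ ∘ proj₁))
    (∑-reindex (Graph.finite-E ⟦ S ⟧) (↔-sym (≅⇒edges iso)) (label {G} ℓ ∘ inj₂ ∘ proj₁))

module _ {G : Graph} (t : Triangle G) where
  open Graph G
  open Triangle t

  corner-distinct : ∀ i → corner i ≢ corner (next i)
  corner-distinct i eq = contra (joins i)
    where
    contra : Joins (side i) (corner i) (corner (next i)) → ⊥
    contra (inj₁ (p , q)) = loopless (side i) (trans p (trans eq (sym q)))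
    contra (inj₂ (p , q)) = loopless (side i) (trans p (trans (sym eq) (sym q)))

  -- Any two different elements of `Fin 3` are neighbours under `next` in one order or the other, so
  -- `corner-distinct` settles each case.
  corner-injective : ∀ i k → corner i ≡ corner k → i ≡ k
  corner-injective 0F 0F _  = refl
  corner-injective 0F 1F eq = ⊥-elim (corner-distinct 0F eq)
  corner-injective 0F 2F eq = ⊥-elim (corner-distinct 2F (sym eq))
  corner-injective 1F 0F eq = ⊥-elim (corner-distinct 0F (sym eq))
  corner-injective 1F 1F _  = refl
  corner-injective 1F 2F eq = ⊥-elim (corner-distinct 1F eq)
  corner-injective 2F 0F eq = ⊥-elim (corner-distinct 2F eq)
  corner-injective 2F 1F eq = ⊥-elim (corner-distinct 1F (sym eq))
  corner-injective 2F 2F _  = refl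

  corner? : ∀ v → Dec (∃[ i ] corner i ≡ v)
  corner? v = any? (λ i → finite-≟ finite-V (corner i) v)

  side? : ∀ e → Dec (∃[ i ] side i ≡ e)
  side? e = any? (λ i → finite-≟ finite-E (side i) e)

  triangle⇒subgraph : Subgraph G
  triangle⇒subgraph = record
    { V′     = λ v → ⌊ corner? v ⌋
    ; E′     = λ e → ⌊ side? e ⌋
    ; end₁-∈ = λ e p → fromWitness (proj₁ (ends (toWitness p)))
    ; end₂-∈ = λ e p → fromWitness (proj₂ (ends (toWitness p)))
    }
    where
    ends : ∀ {e} → ∃[ i ] side i ≡ e → (∃[ k ] corner k ≡ end₁ e) × (∃[ k ] corner k ≡ end₂ e)
    ends (i , refl) with joins i
    ... | inj₁ (p , q) = (i , sym p) , (next i , sym q)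
    ... | inj₂ (p , q) = (next i , sym p) , (i , sym q)

  open Subgraph triangle⇒subgraph

  side-∈ : ∀ i → side i ∈ E′
  side-∈ i = fromWitness {a? = side? (side i)} (i , refl)

  corners : Elements V′ ↔ Fin 3
  corners = mk↔ₛ′
    (λ (v , p) → proj₁ (toWitness {a? = corner? v} p))
    (λ i → corner i , fromWitness {a? = corner? (corner i)} (i , refl))
    -- The search behind `corner?` may return a different index with the same corner; injectivity
    -- identifies it with `i`.
    (λ i → corner-injective _ _ (proj₂ (toWitness {a? = corner? (corner i)} _)))
    (λ (v , p) → Elements-≡ V′ (proj₂ (toWitness {a? = corner? v} p)))

  -- The edge carries its own membership proof `p`, so that the lemma serves both an arbitrary edge
  -- of the subgraph and `side i` itself.
  side-joins : ∀ i {e} (p : e ∈ E′) → side i ≡ e → Graph.Joins ⟦ triangle⇒subgraph ⟧ (e , p) (from corners i) (from corners (next i))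
  side-joins i p refl with joins i
  ... | inj₁ (q , r) = inj₁ (Elements-≡ V′ q , Elements-≡ V′ r)
  ... | inj₂ (q , r) = inj₂ (Elements-≡ V′ q , Elements-≡ V′ r)

  triangle⇒subgraph-≅ : ⟦ triangle⇒subgraph ⟧ ≅ C₃
  triangle⇒subgraph-≅ = record
    { vertices = corners
    ; adjacent = λ u v → mk⇔ there back
    }
    where
    there : ∀ {u v} → Graph.Adjacent ⟦ triangle⇒subgraph ⟧ u v → Graph.Adjacent C₃ (to corners u) (to corners v)
    there ((e , p) , j) = i ,
      -- The pair `i`, `next i` is carried first to the stored ends of `e` and from there to `u`,
      -- `v`; either move may flip it.
      joins-map (to corners) {P = C₃.Joins i} swap j
        (joins-map (to corners) {P = C₃.Joins i} swap (ends-sym (side-joins i p (proj₂ (toWitness {a? = side? e} p))))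
          (subst₂ (C₃.Joins i) (sym (strictlyInverseˡ corners i)) (sym (strictlyInverseˡ corners (next i))) (joins-ends C₃)))
      where
      module C₃ = Graph C₃
      i = proj₁ (toWitness {a? = side? e} p)

    back : ∀ {u v} → Graph.Adjacent C₃ (to corners u) (to corners v) → Graph.Adjacent ⟦ triangle⇒subgraph ⟧ u v
    back {u} {v} (i , j) = (side i , side-∈ i) ,
      subst₂ (Graph.Joins ⟦ triangle⇒subgraph ⟧ (side i , side-∈ i)) (strictlyInverseʳ corners u) (strictlyInverseʳ corners v)
        (joins-map (from corners) {P = (Graph.Joins ⟦ triangle⇒subgraph ⟧ (side i , side-∈ i))} swap j (side-joins i (side-∈ i) refl))

-- Each triangle spans a copy of `C₃`, and each copy of `C₃` yields a triangle of the same weight,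
-- so covering and magic sum can both be checked on triangles.
supermagic-by-triangles : ∀ {G} → (∀ e → ∃[ t ] ∃[ i ] Triangle.side {G} t i ≡ e) →
  (ℓ : Labeling G) → (∃[ c ] ∀ t → triangle-weight {G} (label {G} ℓ ∘ inj₁) (label {G} ℓ ∘ inj₂) t ≡ c) →
  (∀ k → (∃[ v ] label {G} ℓ (inj₁ v) ≡ k) ⇔ (1 ≤ k × k ≤ Graph.∣V∣ G)) →
  Supermagic C₃ G
supermagic-by-triangles {G} cover ℓ (c , magic) super =
    (λ e → covering e (cover e))
  , ℓ , (c , λ S iso → trans (weight≡triangle-weight S iso ℓ) (magic (subgraph⇒triangle S iso))) , super
  where
  covering : ∀ e → ∃[ t ] ∃[ i ] Triangle.side {G} t i ≡ e → ∃[ S ] e ∈ Subgraph.E′ {G} S × ⟦ S ⟧ ≅ C₃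
  covering e (t , i , refl) = triangle⇒subgraph t , side-∈ t i , triangle⇒subgraph-≅ t

-- Labellings

vertices-first : ∀ (G : Graph) → (Graph.V G ↔ Fin (Graph.∣V∣ G)) → (Graph.E G ↔ Fin (Graph.∣E∣ G)) → Labeling G
vertices-first G ν ε = ↔⇒⤖ (↔-sym +↔⊎ ↔-∘ (ν ⊎-↔ ε))

module _ (G : Graph) (ν : Graph.V G ↔ Fin (Graph.∣V∣ G)) (ε : Graph.E G ↔ Fin (Graph.∣E∣ G)) where
  open Graph G

  vertex-label : ∀ v → label {G} (vertices-first G ν ε) (inj₁ v) ≡ suc (toℕ (to ν v))
  vertex-label v = cong suc (toℕ-↑ˡ (to ν v) ∣E∣)

  edge-label : ∀ e → label {G} (vertices-first G ν ε) (inj₂ e) ≡ suc (∣V∣ + toℕ (to ε e))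
  edge-label e = cong suc (toℕ-↑ʳ ∣V∣ (to ε e))

  vertices-first-super : ∀ k → (∃[ v ] label {G} (vertices-first G ν ε) (inj₁ v) ≡ k) ⇔ (1 ≤ k × k ≤ ∣V∣)
  vertices-first-super k = mk⇔
    (λ { (v , refl) → s≤s z≤n , subst (_≤ ∣V∣) (sym (vertex-label v)) (toℕ<n (to ν v)) })
    -- Labels start at 1, so label `k` sits on the vertex numbered `k - 1`; `k≤` is exactly the
    -- bound for that predecessor.
    (λ { (s≤s z≤n , k≤) → from ν (fromℕ< k≤) , trans (vertex-label _)
         (cong suc (trans (cong toℕ (strictlyInverseˡ ν _)) (toℕ-fromℕ< k≤))) })

-- The factors are swapped so that the copies of one object receive consecutive values: the copy
-- index becomes the low digit.
columnwise : ∀ m k → (Fin m × Fin k) ↔ Fin (m * k)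
columnwise m k = cast-id (*-comm k m) ↔-∘ (↔-sym *↔× ↔-∘ ×-comm (Fin m) (Fin k))

toℕ-columnwise : ∀ {m k} (j : Fin m) (x : Fin k) → toℕ (to (columnwise m k) (j , x)) ≡ m * toℕ x + toℕ j
toℕ-columnwise {m} {k} j x = trans (toℕ-cast (*-comm k m) (combine x j)) (toℕ-combine x j)

opposite-complement : ∀ {n} (i : Fin n) → suc (toℕ (opposite i) + toℕ i) ≡ n
opposite-complement {n} i = begin
  suc (toℕ (opposite i) + toℕ i) ≡⟨ +-suc (toℕ (opposite i)) (toℕ i) ⟨
  toℕ (opposite i) + suc (toℕ i) ≡⟨ cong (_+ suc (toℕ i)) (opposite-prop i) ⟩
  n ∸ suc (toℕ i) + suc (toℕ i)  ≡⟨ m∸n+n≡m (toℕ<n i) ⟩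
  n                              ∎
  where open ≡-Reasoning

-- Even positions go to the left, odd positions to the right.
halves : ∀ n → Fin n ↔ (Fin ⌈ n /2⌉ ⊎ Fin ⌊ n /2⌋)
halves zero    = mk↔ₛ′ (λ ()) (λ { (inj₁ ()) ; (inj₂ ()) }) (λ { (inj₁ ()) ; (inj₂ ()) }) (λ ())
halves (suc n) = shifted ↔-∘ step
  where
  step : Fin (suc n) ↔ (Fin 1 ⊎ (Fin ⌈ n /2⌉ ⊎ Fin ⌊ n /2⌋))
  step = (↔-id (Fin 1) ⊎-↔ halves n) ↔-∘ +↔⊎

  -- Prepending a position flips the parity of all others: the halves trade places, and the old odd
  -- positions move up by one behind the new position 0.
  shifted : (Fin 1 ⊎ (Fin ⌈ n /2⌉ ⊎ Fin ⌊ n /2⌋)) ↔ (Fin (suc ⌊ n /2⌋) ⊎ Fin ⌈ n /2⌉)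
  shifted = mk↔ₛ′
    (λ { (inj₁ 0F) → inj₁ 0F ; (inj₂ (inj₁ a)) → inj₂ a ; (inj₂ (inj₂ b)) → inj₁ (suc b) })
    (λ { (inj₁ 0F) → inj₁ 0F ; (inj₁ (suc b)) → inj₂ (inj₂ b) ; (inj₂ a) → inj₂ (inj₁ a) })
    (λ { (inj₁ 0F) → refl ; (inj₁ (suc b)) → refl ; (inj₂ a) → refl })
    (λ { (inj₁ 0F) → refl ; (inj₂ (inj₁ a)) → refl ; (inj₂ (inj₂ b)) → refl })

evens-first : ∀ n → Fin n ↔ Fin n
evens-first n = cast-id (trans (+-comm ⌈ n /2⌉ ⌊ n /2⌋) (⌊n/2⌋+⌈n/2⌉≡n n)) ↔-∘ (↔-sym +↔⊎ ↔-∘ halves n)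

-- The sequence 0, h, 1, h + 1, 2, and so on: `evens-first` as a function on all naturals, free of
-- the bounds of `Fin`.
alternate : ℕ → ℕ → ℕ
alternate h zero          = 0
alternate h (suc zero)    = h
alternate h (suc (suc i)) = suc (alternate h i)

-- Two positions further, each summand has grown by 1, so the sum grows by 2 just as the position
-- does.
alternate-consecutive : ∀ h i → alternate h i + alternate h (suc i) ≡ h + i
alternate-consecutive h zero          = +-comm 0 h
alternate-consecutive h (suc zero)    = refl
alternate-consecutive h (suc (suc i)) = begin
  suc (alternate h i + suc (alternate h (suc i)))   ≡⟨ cong suc (+-suc (alternate h i) (alternate h (suc i))) ⟩
  suc (suc (alternate h i + alternate h (suc i)))   ≡⟨ cong (2 +_) (alternate-consecutive h i) ⟩
  suc (suc (h + i))                                 ≡⟨ cong suc (+-suc h i) ⟨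
  suc (h + suc i)                                   ≡⟨ +-suc h (suc i) ⟨
  h + suc (suc i)                                   ∎
  where open ≡-Reasoning

-- Induction in steps of two: prepending two positions swaps the halves twice, so an element stays
-- in its half and moves up by one.
alternate-halves : ∀ {n} h (i : Fin n) → [ toℕ , (λ b → h + toℕ b) ]′ (to (halves n) i) ≡ alternate h (toℕ i)
alternate-halves             h zero          = refl
alternate-halves {suc (suc n)} h (suc zero)    = +-comm h 0
alternate-halves {suc (suc n)} h (suc (suc i)) with to (halves n) i | alternate-halves h i
... | inj₁ a | eq = cong suc eq
... | inj₂ b | eq = trans (+-suc h (toℕ b)) (cong suc eq)

toℕ-evens-first : ∀ {n} (i : Fin n) → toℕ (to (evens-first n) i) ≡ alternate ⌈ n /2⌉ (toℕ i)
toℕ-evens-first {n} i = trans (toℕ-cast _ (from +↔⊎ (to (halves n) i))) (trans (toℕ-join (to (halves n) i)) (alternate-halves ⌈ n /2⌉ i))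
  where
  toℕ-join : ∀ x → toℕ (from (+↔⊎ {⌈ n /2⌉} {⌊ n /2⌋}) x) ≡ [ toℕ , (λ b → ⌈ n /2⌉ + toℕ b) ]′ x
  toℕ-join (inj₁ a) = toℕ-↑ˡ a ⌊ n /2⌋
  toℕ-join (inj₂ b) = toℕ-↑ʳ ⌈ n /2⌉ b

evens-first-consecutive : ∀ {n} (i : Fin n) →
  toℕ (to (evens-first (suc n)) (inject₁ i)) + toℕ (to (evens-first (suc n)) (suc i)) ≡ ⌈ suc n /2⌉ + toℕ i
evens-first-consecutive {n} i = begin
  toℕ (to (evens-first (suc n)) (inject₁ i)) + toℕ (to (evens-first (suc n)) (suc i))
    ≡⟨ cong₂ _+_ (toℕ-evens-first (inject₁ i)) (toℕ-evens-first (suc i)) ⟩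
  alternate ⌈ suc n /2⌉ (toℕ (inject₁ i)) + alternate ⌈ suc n /2⌉ (suc (toℕ i))
    ≡⟨ cong (λ k → alternate ⌈ suc n /2⌉ k + alternate ⌈ suc n /2⌉ (suc (toℕ i))) (toℕ-inject₁ i) ⟩
  alternate ⌈ suc n /2⌉ (toℕ i) + alternate ⌈ suc n /2⌉ (suc (toℕ i))
    ≡⟨ alternate-consecutive ⌈ suc n /2⌉ (toℕ i) ⟩
  ⌈ suc n /2⌉ + toℕ i ∎
  where open ≡-Reasoning

-- Here `r` and `s` are the spoke numbers, and `a`, `b`, `d` the labels of spoke, path edge and
-- spoke. The vertex labels exceed `3 + 3 * m` by `3 * j + 2 * (m * i)`, and the edge labels fall
-- short of `3 * K - m * (h + (1 + n))` by the same amount. Terms are moved across to avoid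
-- truncated subtraction.
triangle-arithmetic : ∀ m n h i j r s a b d K → r + s ≡ h + i →
  a + (m * r + j) ≡ K → b + (m * (1 + n + i) + j) ≡ K → d + (m * s + j) ≡ K →
  (1 + (m * 0 + j)) + ((1 + (m * (1 + i) + j)) + ((1 + (m * (2 + i) + j)) + 0)) + (a + (b + (d + 0)))
    + m * (h + (1 + n)) ≡ 3 * K + 3 + 3 * m
-- The cancelled summand supplies the shortfall of the edge labels, which lets the three edge
-- equations be applied as sums.
triangle-arithmetic m n h i j r s a b d K consecutive a-eq b-eq d-eq = +-cancelˡ-≡ (3 * j + 2 * (m * i)) _ _ (begin
  (3 * j + 2 * (m * i)) + ((1 + (m * 0 + j)) + ((1 + (m * (1 + i) + j)) + ((1 + (m * (2 + i) + j)) + 0)) + (a + (b + (d + 0))) + m * (h + (1 + n)))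
    ≡⟨ gather m n h i j a b d ⟩
  shape (h + i)
    ≡⟨ cong shape consecutive ⟨
  shape (r + s)
    ≡⟨ distribute m n i j r s a b d ⟩
  (3 * j + 2 * (m * i)) + ((a + (m * r + j)) + (b + (m * (1 + n + i) + j)) + (d + (m * s + j)) + 3 + 3 * m)
    ≡⟨ cong (λ x → (3 * j + 2 * (m * i)) + (x + 3 + 3 * m)) (cong₂ _+_ (cong₂ _+_ a-eq b-eq) d-eq) ⟩
  (3 * j + 2 * (m * i)) + (K + K + K + 3 + 3 * m)
    ≡⟨ cong (λ x → (3 * j + 2 * (m * i)) + (x + 3 + 3 * m)) (triple K) ⟩
  (3 * j + 2 * (m * i)) + (3 * K + 3 + 3 * m) ∎)
  where
  open ≡-Reasoning
  shape : ℕ → ℕ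
  shape x = 3 + 3 * m + (a + b + d) + m * x + m * (1 + n + i) + 3 * j + (3 * j + 2 * (m * i))
  gather : ∀ m n h i j a b d →
    (3 * j + 2 * (m * i)) + ((1 + (m * 0 + j)) + ((1 + (m * (1 + i) + j)) + ((1 + (m * (2 + i) + j)) + 0)) + (a + (b + (d + 0))) + m * (h + (1 + n)))
    ≡ 3 + 3 * m + (a + b + d) + m * (h + i) + m * (1 + n + i) + 3 * j + (3 * j + 2 * (m * i))
  gather = solve-∀
  distribute : ∀ m n i j r s a b d →
    3 + 3 * m + (a + b + d) + m * (r + s) + m * (1 + n + i) + 3 * j + (3 * j + 2 * (m * i))
    ≡ (3 * j + 2 * (m * i)) + ((a + (m * r + j)) + (b + (m * (1 + n + i) + j)) + (d + (m * s + j)) + 3 + 3 * m)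
  distribute = solve-∀
  triple : ∀ K → K + K + K ≡ 3 * K
  triple = solve-∀

-- Triangles of disjoint unions of fans

module _ (m n : ℕ) where
  private
    -- `n` counts the path edges of each fan, hence also its triangles.
    G = m copies-of Fan (suc n)
    module F = Graph G

  -- Only path edges join two rim vertices, and their ends are successive positions. This
  -- 2-colouring of the rim excludes triangles inside it.
  rim-parity : ∀ {e j j′ i k} → F.Joins e (j , rim i) (j′ , rim k) → parity (toℕ i) ≡ parity (toℕ k) ⁻¹
  rim-parity {j , spoke l} (inj₁ (() , _))
  rim-parity {j , spoke l} (inj₂ (() , _))
  rim-parity {j , path l} (inj₁ (refl , refl)) =
    trans (cong parity (toℕ-inject₁ l)) (sym (suc-homo-⁻¹ (toℕ l)))
  rim-parity {j , path l} (inj₂ (refl , refl)) =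
    trans (⁻¹-flip (suc-homo-⁻¹ (toℕ l))) (cong (_⁻¹ ∘ parity) (sym (toℕ-inject₁ l)))
    where
    ⁻¹-flip : ∀ {p q} → p ⁻¹ ≡ q → p ≡ q ⁻¹
    ⁻¹-flip {p} refl = sym (⁻¹-involutive p)

  fan-triangle : Fin m → Fin n → Triangle G
  fan-triangle j i = record
    { corner = λ { 0F → j , centre ; 1F → j , rim (inject₁ i) ; 2F → j , rim (suc i) }
    ; side   = λ { 0F → j , spoke (inject₁ i) ; 1F → j , path i ; 2F → j , spoke (suc i) }
    ; joins  = λ { 0F → inj₁ (refl , refl) ; 1F → inj₁ (refl , refl) ; 2F → inj₂ (refl , refl) }
    }

  module _ (f : F.V → ℕ) (g : F.E → ℕ) (c : ℕ)
    (magic : ∀ j i → triangle-weight {G} f g (fan-triangle j i) ≡ c)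
    where

    -- Both edges at the centre must be spokes of copy `j`, so the third joins two rim vertices and
    -- is a path edge. The triangle is then a `fan-triangle`, traversed in one of two directions.
    centred : ∀ {j v w a b d} → F.Joins a (j , centre) v → F.Joins b v w → F.Joins d w (j , centre) →
      (f (j , centre) + (f v + (f w + 0))) + (g a + (g b + (g d + 0))) ≡ c
    centred {a = j , spoke i} {_ , spoke k} (inj₁ (refl , refl)) (inj₁ (() , _)) _
    -- A second spoke leads back to the centre, which would make `d` a loop.
    centred {a = j , spoke i} {_ , spoke k} (inj₁ (refl , refl)) (inj₂ (refl , refl)) (inj₁ (p , q)) = ⊥-elim (F.loopless _ (trans p (sym q)))
    centred {a = j , spoke i} {_ , spoke k} (inj₁ (refl , refl)) (inj₂ (refl , refl)) (inj₂ (p , q)) = ⊥-elim (F.loopless _ (trans p (sym q)))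
    centred {a = j , spoke i} {_ , path l} {_ , path k} (inj₁ (refl , refl)) _ (inj₁ (_ , ()))
    centred {a = j , spoke i} {_ , path l} {_ , path k} (inj₁ (refl , refl)) _ (inj₂ (() , _))
    centred {a = j , spoke i} {_ , path l} {_ , spoke k} (inj₁ (refl , refl)) _ (inj₁ (_ , ()))
    centred {a = j , spoke i} {_ , path l} {_ , spoke k} (inj₁ (refl , refl)) (inj₁ (refl , refl)) (inj₂ (refl , refl)) = magic j l
    -- The path edge is traversed backwards: the rim corners and the spokes are exchanged.
    centred {a = j , spoke i} {_ , path l} {_ , spoke k} (inj₁ (refl , refl)) (inj₂ (refl , refl)) (inj₂ (refl , refl)) =
      trans (reflect (f (j , centre)) (f (j , rim i)) (f (j , rim k)) (g (j , spoke i)) (g (j , path l)) (g (j , spoke k)))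
        (magic j l)
      where
      reflect : ∀ u v w a b d → (u + (v + (w + 0))) + (a + (b + (d + 0))) ≡ (u + (w + (v + 0))) + (d + (b + (a + 0)))
      reflect = solve-∀
    centred {a = j , spoke i} (inj₂ (refl , ())) _ _
    centred {a = j , path i} (inj₁ (() , _)) _ _
    centred {a = j , path i} (inj₂ (_ , ())) _ _

    -- The triangle is rotated until a centre comes first.
    any-triangle : ∀ {u v w a b d} → F.Joins a u v → F.Joins b v w → F.Joins d w u →
      (f u + (f v + (f w + 0))) + (g a + (g b + (g d + 0))) ≡ c
    any-triangle {_ , centre} p q r = centred p q r
    any-triangle {u@(_ , rim _)} {v@(_ , centre)} {w} {a} {b} {d} p q r =
      trans (rotate (f u) (f v) (f w) (g a) (g b) (g d)) (centred q r p)
      where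
      rotate : ∀ u v w a b d → (u + (v + (w + 0))) + (a + (b + (d + 0))) ≡ (v + (w + (u + 0))) + (b + (d + (a + 0)))
      rotate = solve-∀
    any-triangle {u@(_ , rim _)} {v@(_ , rim _)} {w@(_ , centre)} {a} {b} {d} p q r =
      trans (rotate (f u) (f v) (f w) (g a) (g b) (g d)) (centred r p q)
      where
      rotate : ∀ u v w a b d → (u + (v + (w + 0))) + (a + (b + (d + 0))) ≡ (w + (u + (v + 0))) + (d + (a + (b + 0)))
      rotate = solve-∀
    -- Without a centre, going round flips the parity of the position three times, yet returns to
    -- the start.
    any-triangle {_ , rim i} {_ , rim k} {_ , rim l} p q r = ⊥-elim (p≢p⁻¹ _
      (trans (rim-parity p) (cong _⁻¹ (trans (rim-parity q) (trans (cong _⁻¹ (rim-parity r)) (⁻¹-involutive _))))))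

    all-triangles : ∀ t → triangle-weight {G} f g t ≡ c
    all-triangles t = any-triangle (joins 0F) (joins 1F) (joins 2F)
      where open Triangle {G} t

  fan-covered : 1 ≤ n → ∀ e → ∃[ t ] ∃[ i ] Triangle.side {G} t i ≡ e
  -- The first spoke has no triangle before it and takes the one after it; matching on `1 ≤ n` makes
  -- that triangle available.
  fan-covered (s≤s _) (j , spoke zero)    = fan-triangle j zero , 0F , refl
  fan-covered _       (j , spoke (suc i)) = fan-triangle j i , 2F , refl
  fan-covered _       (j , path i)        = fan-triangle j i , 1F , refl

  -- The labelling of the fans and its magic constant

  vertex-number : F.V ↔ Fin F.∣V∣
  vertex-number = columnwise m (2 + n) ↔-∘ (↔-id (Fin m) ×-↔ ↔-sym (Finite.enum (finite-FanVertex (suc n))))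

  FanEdge-⊎ : FanEdge (suc n) ↔ (Fin (suc n) ⊎ Fin n)
  FanEdge-⊎ = mk↔ₛ′
    (λ { (spoke i) → inj₁ i ; (path i) → inj₂ i })
    (λ { (inj₁ i) → spoke i ; (inj₂ i) → path i })
    (λ { (inj₁ i) → refl ; (inj₂ i) → refl })
    (λ { (spoke i) → refl ; (path i) → refl })

  fan-edge-number : FanEdge (suc n) ↔ Fin (suc n + n)
  fan-edge-number = ↔-sym +↔⊎ ↔-∘ ((evens-first (suc n) ⊎-↔ ↔-id (Fin n)) ↔-∘ FanEdge-⊎)

  edge-number : F.E ↔ Fin F.∣E∣
  edge-number = columnwise m (suc n + n) ↔-∘ (↔-id (Fin m) ×-↔ fan-edge-number)

  fan-labeling : Labeling G
  fan-labeling = vertices-first G vertex-number (reverse ↔-∘ edge-number)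

  private
    f : F.V → ℕ
    f = label {G} fan-labeling ∘ inj₁

    g : F.E → ℕ
    g = label {G} fan-labeling ∘ inj₂

  label-centre : ∀ j → f (j , centre) ≡ 1 + (m * 0 + toℕ j)
  label-centre j = trans (vertex-label G vertex-number (reverse ↔-∘ edge-number) (j , centre)) (cong suc (toℕ-columnwise j zero))

  label-rim : ∀ j i → f (j , rim i) ≡ 1 + (m * (1 + toℕ i) + toℕ j)
  label-rim j i = trans (vertex-label G vertex-number (reverse ↔-∘ edge-number) (j , rim i)) (cong suc (toℕ-columnwise j (suc i)))

  -- Reversal makes an edge label and the unreversed number complementary. The sum form is what
  -- `triangle-arithmetic` takes.
  label-edge : ∀ j e → g (j , e) + (m * toℕ (to fan-edge-number e) + toℕ j) ≡ F.∣V∣ + F.∣E∣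
  label-edge j e = begin
    g (j , e) + (m * toℕ x + toℕ j)
      ≡⟨ cong₂ _+_ (edge-label G vertex-number (reverse ↔-∘ edge-number) (j , e)) (sym (toℕ-columnwise j x)) ⟩
    suc (F.∣V∣ + toℕ (opposite y)) + toℕ y
      ≡⟨ cong suc (+-assoc F.∣V∣ (toℕ (opposite y)) (toℕ y)) ⟩
    suc (F.∣V∣ + (toℕ (opposite y) + toℕ y))
      ≡⟨ +-suc F.∣V∣ _ ⟨
    F.∣V∣ + suc (toℕ (opposite y) + toℕ y)
      ≡⟨ cong (F.∣V∣ +_) (opposite-complement y) ⟩
    F.∣V∣ + F.∣E∣ ∎
    where
    open ≡-Reasoning
    x = to fan-edge-number e
    y = to (columnwise m (suc n + n)) (j , x)

  label-spoke : ∀ j i → g (j , spoke i) + (m * toℕ (to (evens-first (suc n)) i) + toℕ j) ≡ F.∣V∣ + F.∣E∣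
  label-spoke j i = subst (λ x → g (j , spoke i) + (m * x + toℕ j) ≡ F.∣V∣ + F.∣E∣)
    (toℕ-↑ˡ (to (evens-first (suc n)) i) n) (label-edge j (spoke i))

  label-path : ∀ j i → g (j , path i) + (m * (1 + n + toℕ i) + toℕ j) ≡ F.∣V∣ + F.∣E∣
  label-path j i = subst (λ x → g (j , path i) + (m * x + toℕ j) ≡ F.∣V∣ + F.∣E∣)
    (toℕ-↑ʳ (suc n) i) (label-edge j (path i))

  -- The equation of `triangle-arithmetic` solved for the weight; the truncated subtraction is exact
  -- whenever there is a fan triangle.
  fan-triangle-constant : ℕ
  fan-triangle-constant = 3 * (F.∣V∣ + F.∣E∣) + 3 + 3 * m ∸ m * (⌈ suc n /2⌉ + (1 + n))

  label-fan-triangle : ∀ j i → triangle-weight {G} f g (fan-triangle j i) ≡ fan-triangle-constant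
  label-fan-triangle j i = begin
    triangle-weight {G} f g (fan-triangle j i)
      ≡⟨ cong (_+ (g (j , spoke (inject₁ i)) + (g (j , path i) + (g (j , spoke (suc i)) + 0))))
           (cong₂ _+_ (label-centre j) (cong₂ _+_ rim₁ (cong (_+ 0) (label-rim j (suc i))))) ⟩
    X
      ≡⟨ m+n∸n≡m X (m * (⌈ suc n /2⌉ + (1 + n))) ⟨
    X + m * (⌈ suc n /2⌉ + (1 + n)) ∸ m * (⌈ suc n /2⌉ + (1 + n))
      ≡⟨ cong (_∸ m * (⌈ suc n /2⌉ + (1 + n))) (triangle-arithmetic m n ⌈ suc n /2⌉ (toℕ i) (toℕ j) _ _ _ _ _ _
           (evens-first-consecutive i) (label-spoke j (inject₁ i)) (label-path j i) (label-spoke j (suc i))) ⟩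
    fan-triangle-constant ∎
    where
    open ≡-Reasoning
    rim₁ : f (j , rim (inject₁ i)) ≡ 1 + (m * (1 + toℕ i) + toℕ j)
    rim₁ = trans (label-rim j (inject₁ i)) (cong (λ x → 1 + (m * (1 + x) + toℕ j)) (toℕ-inject₁ i))
    X : ℕ
    X = (1 + (m * 0 + toℕ j)) + ((1 + (m * (1 + toℕ i) + toℕ j)) + ((1 + (m * (2 + toℕ i) + toℕ j)) + 0))
      + (g (j , spoke (inject₁ i)) + (g (j , path i) + (g (j , spoke (suc i)) + 0)))

  fans-supermagic : 1 ≤ n → Supermagic C₃ G
  fans-supermagic 1≤n = supermagic-by-triangles {G} (fan-covered 1≤n) fan-labeling
    (fan-triangle-constant , all-triangles f g fan-triangle-constant label-fan-triangle)
    (vertices-first-super G vertex-number (reverse ↔-∘ edge-number))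

theorem2 : (m n : ℕ) → 2 ≤ m → 3 ≤ n → Supermagic C₃ (m copies-of Fan n)
theorem2 m (suc n) _ (s≤s 2≤n) = fans-supermagic m n (≤-trans (s≤s z≤n) 2≤n)
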